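{- For every positive integer $n$, $f(n,3,3)\le 2\lg n+6$, where $\lg$ denotes the logarithm in base $2$.
   Context: A $3$-digraph $G$ consists of a finite vertex set $V(G)$ and an edge set $E(G)$ whose elements are ordered triples of distinct vertices. A $(3,k)$-tournament is a $3$-digraph $G$ such that for every $3$-element set $S\subseteq V(G)$, exactly $k$ of the $6$ orderings of $S$ are edges of $G$. The tight path $P^{(3)}_s$ is the $3$-digraph with $s$ distinct vertices $v_1,\ldots,v_s$ whose edges are exactly the triples $(v_i,v_{i+1},v_{i+2})$, $1\le i\le s-2$ (no edges if $s<3$). A $3$-digraph $G$ contains $P^{(3)}_s$ if there is an injection of its vertices into $V(G)$ mapping edges to edges. $f(n,3,k)$ is the maximum integer $s$ such that every $n$-vertex $(3,k)$-tournament contains a copy of $P^{(3)}_s$. -}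

module Defs where

open import Data.Bool using (Bool; true; false; T)
open import Data.Bool.Properties using (T?)
open import Data.Empty using (⊥-elim)
open import Data.Fin using (Fin; zero; suc; toℕ)
open import Data.Fin.Properties using (_≟_; any?; all?; injective⇒≤)
open import Data.List using (List; []; _∷_; length; filter)
open import Data.List.Properties using (filter-≐)
open import Data.Nat as ℕ using (ℕ; zero; suc; _≤_; z≤n)
import Data.Nat.Properties as ℕ
open import Data.Product using (_×_; _,_; ∃; proj₁)
import Data.Vec.Functional as Vector
open import Function using (Injective; _∘_)
open import Level using (0ℓ)
open import Relation.Binary using (Rel; Reflexive; _Respects_)
open import Relation.Binary.PropositionalEquality
  using (_≡_; _≢_; refl; sym; trans; cong; subst)
open import Relation.Nullary using (¬_; Dec; yes; no)
open import Relation.Nullary.Decidable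
  using (_×-dec_; _⊎-dec_; _→-dec_; ¬?; map′; ⌊_⌋; toWitness; decidable-stable)
open import Data.Sum using (_⊎_; inj₁; inj₂)
open import Relation.Unary using (Pred; Decidable)

------------------------------------------------------------------------
-- 3-digraphs on the vertex set Fin n

Distinct : ∀ {n} → Fin n → Fin n → Fin n → Set
Distinct a b c = a ≢ b × b ≢ c × a ≢ c

TripleSet : ℕ → Set
TripleSet n = Fin n → Fin n → Fin n → Bool

record Digraph₃ (n : ℕ) : Set where
  constructor digraph
  field
    edge     : TripleSet n
    distinct : ∀ a b c → T (edge a b c) → Distinct a b c

open Digraph₃ public

Edge : ∀ {n} → Digraph₃ n → Fin n → Fin n → Fin n → Set
Edge G a b c = T (edge G a b c)

EdgeSet : ∀ {n} → Digraph₃ n → Pred (Fin n × Fin n × Fin n) 0ℓ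
EdgeSet G (a , b , c) = Edge G a b c

edge? : ∀ {n} (G : Digraph₃ n) → Decidable (EdgeSet G)
edge? G (a , b , c) = T? (edge G a b c)

orderings : ∀ {A : Set} → A → A → A → List (A × A × A)
orderings a b c =
  (a , b , c) ∷ (a , c , b) ∷ (b , a , c) ∷
  (b , c , a) ∷ (c , a , b) ∷ (c , b , a) ∷ []

edgeCount : ∀ {n} → Digraph₃ n → Fin n → Fin n → Fin n → ℕ
edgeCount G a b c =
  length (filter (edge? G) (orderings a b c))

-- The 3-element sets are the sets {a , b , c} with a, b, c distinct.
IsTournament : ∀ {n} → ℕ → Digraph₃ n → Set
IsTournament k G = ∀ a b c → Distinct a b c → edgeCount G a b c ≡ k

Consecutive : ∀ {s} → Fin s → Fin s → Fin s → Set
Consecutive i j k = toℕ j ≡ suc (toℕ i) × toℕ k ≡ suc (toℕ j)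

consecutive? : ∀ {s} (i j k : Fin s) → Dec (Consecutive i j k)
consecutive? i j k =
  (toℕ j ℕ.≟ suc (toℕ i)) ×-dec (toℕ k ℕ.≟ suc (toℕ j))

consecutive⇒distinct : ∀ {s} (i j k : Fin s) → Consecutive i j k → Distinct i j k
consecutive⇒distinct i j k (j≡1+i , k≡1+j) =
    (λ i≡j → ℕ.<⇒≢ i<j (cong toℕ i≡j))
  , (λ j≡k → ℕ.<⇒≢ j<k (cong toℕ j≡k))
  , (λ i≡k → ℕ.<⇒≢ (ℕ.<-trans i<j j<k) (cong toℕ i≡k))
  where
  i<j : toℕ i ℕ.< toℕ j
  i<j = ℕ.≤-reflexive (sym j≡1+i)
  j<k : toℕ j ℕ.< toℕ k
  j<k = ℕ.≤-reflexive (sym k≡1+j)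

tightPath : ∀ s → Digraph₃ s
tightPath s = digraph
  (λ i j k → ⌊ consecutive? i j k ⌋)
  (λ i j k e → consecutive⇒distinct i j k (toWitness {a? = consecutive? i j k} e))

IsEmbedding : ∀ {m n} → Digraph₃ m → Digraph₃ n → (Fin m → Fin n) → Set
IsEmbedding H G φ =
  Injective _≡_ _≡_ φ × (∀ i j k → Edge H i j k → Edge G (φ i) (φ j) (φ k))

Contains : ∀ {m n} → Digraph₃ n → Digraph₃ m → Set
Contains G H = ∃ (IsEmbedding H G)

Unavoidable : (n k s : ℕ) → Set
Unavoidable n k s =
  ∀ (G : Digraph₃ n) → IsTournament k G → Contains G (tightPath s)

------------------------------------------------------------------------
-- Unavoidable is decidable.  Function extensionality is not available, so
-- searching through functions requires the predicate to respect pointwise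
-- equality.

Searchable : {A : Set} → Rel A 0ℓ → Set₁
Searchable {A} _≈_ =
  {P : Pred A 0ℓ} → P Respects _≈_ → Decidable P → Dec (∃ P)

Pointwise : {A : Set} → Rel A 0ℓ → ∀ m → Rel (Fin m → A) 0ℓ
Pointwise _≈_ m f g = ∀ i → f i ≈ g i

searchBool : Searchable {Bool} _≡_
searchBool {P} _ P? = map′ to from (P? true ⊎-dec P? false)
  where
  to : P true ⊎ P false → ∃ P
  to (inj₁ p) = true , p
  to (inj₂ p) = false , p
  from : ∃ P → P true ⊎ P false
  from (true  , p) = inj₁ p
  from (false , p) = inj₂ p

searchFin : ∀ {n} → Searchable {Fin n} _≡_
searchFin _ P? = any? P?

searchFunction : ∀ {A : Set} {_≈_ : Rel A 0ℓ} → Reflexive _≈_ →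
                 Searchable _≈_ → ∀ m → Searchable (Pointwise _≈_ m)
searchFunction rfl search zero resp P? =
  map′ (λ p → Vector.[] , p) (λ (_ , p) → resp (λ ()) p) (P? Vector.[])
searchFunction {_≈_ = _≈_} rfl search (suc m) {P} resp P? =
  map′ (λ (x , f , p) → x Vector.∷ f , p)
       (λ (f , p) → Vector.head f , Vector.tail f ,
                    resp (λ { zero → rfl ; (suc _) → rfl }) p)
       (search {λ x → ∃ λ f → P (x Vector.∷ f)}
         (λ x≈y (f , p) → f , resp (λ { zero → x≈y ; (suc _) → rfl }) p)
         (λ x → searchFunction {_≈_ = _≈_} rfl search m
           (λ f≈g → resp (λ { zero → rfl ; (suc i) → f≈g i }))
           (λ f → P? (x Vector.∷ f))))

searchAll : ∀ {A : Set} {_≈_ : Rel A 0ℓ} → (∀ {x y} → x ≈ y → y ≈ x) →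
            Searchable _≈_ → {P : Pred A 0ℓ} → P Respects _≈_ →
            Decidable P → Dec (∀ x → P x)
searchAll ≈-sym search resp P? =
  map′ (λ none x → decidable-stable (P? x) (λ ¬p → none (x , ¬p)))
       (λ all (x , ¬p) → ¬p (all x))
       (¬? (search (λ x≈y ¬p p → ¬p (resp (≈-sym x≈y) p)) (¬? ∘ P?)))

_≗₃_ : ∀ {n} → Rel (TripleSet n) 0ℓ
_≗₃_ {n} = Pointwise (Pointwise (Pointwise _≡_ n) n) n

searchTripleSet : ∀ {n} → Searchable (_≗₃_ {n})
searchTripleSet {n} =
  searchFunction (λ _ _ → refl)
    (searchFunction (λ _ → refl)
      (searchFunction refl searchBool n) n) n

distinct? : ∀ {n} (a b c : Fin n) → Dec (Distinct a b c)
distinct? a b c = ¬? (a ≟ b) ×-dec ¬? (b ≟ c) ×-dec ¬? (a ≟ c)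

all³? : ∀ {n} {P : Fin n → Fin n → Fin n → Set} →
        (∀ a b c → Dec (P a b c)) → Dec (∀ a b c → P a b c)
all³? P? = all? λ a → all? λ b → all? λ c → P? a b c

isTournament? : ∀ {n} k (G : Digraph₃ n) → Dec (IsTournament k G)
isTournament? k G =
  all³? λ a b c → distinct? a b c →-dec (edgeCount G a b c ℕ.≟ k)

injective? : ∀ {m n} (φ : Fin m → Fin n) → Dec (Injective _≡_ _≡_ φ)
injective? φ = map′ (λ inj {i} {j} → inj i j) (λ inj i j → inj {i} {j})
  (all? λ i → all? λ j → (φ i ≟ φ j) →-dec (i ≟ j))

isEmbedding? : ∀ {m n} (H : Digraph₃ m) (G : Digraph₃ n) φ → Dec (IsEmbedding H G φ)
isEmbedding? H G φ = injective? φ ×-dec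
  all³? λ i j k → T? (edge H i j k) →-dec T? (edge G (φ i) (φ j) (φ k))

isEmbedding-resp : ∀ {m n} (H : Digraph₃ m) (G : Digraph₃ n) →
                   IsEmbedding H G Respects Pointwise _≡_ m
isEmbedding-resp H G {φ} {ψ} φ≗ψ (inj , hom) =
    (λ {i} {j} eq → inj (trans (φ≗ψ i) (trans eq (sym (φ≗ψ j)))))
  , λ i j k e → transport (φ≗ψ i) (φ≗ψ j) (φ≗ψ k) (hom i j k e)
  where
  transport : ∀ {a b c a′ b′ c′} → a ≡ a′ → b ≡ b′ → c ≡ c′ →
              Edge G a b c → Edge G a′ b′ c′
  transport refl refl refl e = e

contains? : ∀ {m n} (G : Digraph₃ n) (H : Digraph₃ m) → Dec (Contains G H)
contains? {m} G H =
  searchFunction refl searchFin m (isEmbedding-resp H G) (isEmbedding? H G)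

edgeCount-resp : ∀ {n} (G G′ : Digraph₃ n) → edge G ≗₃ edge G′ →
                 ∀ a b c → edgeCount G a b c ≡ edgeCount G′ a b c
edgeCount-resp G G′ eq a b c = cong length (filter-≐ (edge? G) (edge? G′)
  ( (λ { {x , y , z} → subst T (eq x y z) })
  , (λ { {x , y , z} → subst T (sym (eq x y z)) }))
  (orderings a b c))

unavoidable? : ∀ n k → Decidable (Unavoidable n k)
unavoidable? n k s =
  map′ (λ h G → h (edge G) (distinct G)) (λ h E d → h (digraph E d))
       (searchAll (λ eq a b c → sym (eq a b c)) searchTripleSet resp decide)
  where
  Proper : TripleSet n → Set
  Proper E = ∀ a b c → T (E a b c) → Distinct a b c

  Q : TripleSet n → Set
  Q E = (d : Proper E) → IsTournament k (digraph E d) →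
        Contains (digraph E d) (tightPath s)

  decide : Decidable Q
  decide E with all³? (λ a b c → T? (E a b c) →-dec distinct? a b c)
  ... | no ¬d = yes λ d → ⊥-elim (¬d d)
  ... | yes d = map′ (λ q _ → q) (λ q → q d)
    (isTournament? k (digraph E d) →-dec contains? (digraph E d) (tightPath s))

  resp : Q Respects _≗₃_
  resp {E} {E′} eq q d′ t =
    let φ , inj , hom = q d (λ a b c abc →
          trans (edgeCount-resp (digraph E d) (digraph E′ d′) eq a b c) (t a b c abc))
    in φ , inj , λ i j k e → subst T (eq _ _ _) (hom i j k e)
    where
    d : Proper E
    d a b c e = d′ a b c (subst T (eq a b c) e)

------------------------------------------------------------------------
-- The extremal function

greatest≤ : {P : Pred ℕ 0ℓ} → Decidable P → ℕ → ℕ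
greatest≤ P? zero    = zero
greatest≤ P? (suc m) with P? (suc m)
... | yes _ = suc m
... | no  _ = greatest≤ P? m

-- A copy of the tight path on s vertices needs s ≤ n, so searching up to n
-- is enough whenever some (3,k)-tournament on n vertices exists; see
-- f-isMaximum.  If none exists, there is no maximum and f n k is n.
f : ℕ → ℕ → ℕ
f n k = greatest≤ (unavoidable? n k) n

IsMaximum : Pred ℕ 0ℓ → ℕ → Set
IsMaximum P m = P m × (∀ s → P s → s ≤ m)

greatest≤-isMaximum : {P : Pred ℕ 0ℓ} (P? : Decidable P) → P 0 →
                      ∀ m → (∀ s → P s → s ≤ m) → IsMaximum P (greatest≤ P? m)
greatest≤-isMaximum P? p₀ zero    bound = p₀ , bound
greatest≤-isMaximum P? p₀ (suc m) bound with P? (suc m)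
... | yes p = p , bound
... | no ¬p = greatest≤-isMaximum P? p₀ m λ s p →
  ℕ.≤-pred (ℕ.≤∧≢⇒< (bound s p) λ { refl → ¬p p })

f-isMaximum : ∀ {n k} (G : Digraph₃ n) → IsTournament k G →
              IsMaximum (Unavoidable n k) (f n k)
f-isMaximum {n} {k} G t = greatest≤-isMaximum (unavoidable? n k)
  (λ _ _ → (λ ()) , (λ { {()} }) , λ ()) n
  (λ s u → let _ , inj , _ = u G t in injective⇒≤ inj)

{-# OPTIONS --safe #-}

-- Give the vertices binary labels, and let level x y be the number of binary
-- digits up to the highest one in which x and y differ.  If x < y < z then
-- level x y ≢ level y z.  Take as edges the orderings (x , y , z) with y the
-- largest of the three, together with the monotone orderings along which the
-- level increases: of x < y < z these are two and one orderings.  A tight path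
-- first ascends and then descends, with increasing levels in both phases, so
-- with k-digit labels it has at most about 2 k vertices.
module Submission where

open import Defs
open import Data.Bool using (true; false)
open import Data.Empty using (⊥-elim)
open import Data.Fin using (Fin; zero; suc; toℕ; fromℕ; inject₁)
open import Data.Fin.Properties using (toℕ-inject₁; toℕ-injective; toℕ<n)
open import Data.List using ([]; _∷_)
open import Data.List.Relation.Binary.Permutation.Propositional
  using (_↭_; ↭-refl; swap)
open import Data.List.Relation.Binary.Permutation.Propositional.Properties
  using (++⁺; ++-comm; filter-↭; ↭-length)
open import Data.Nat
  using (ℕ; zero; suc; _+_; _*_; _^_; _≤_; _<_; z≤n; s≤s; z<s; NonZero; ⌊_/2⌋; ⌈_/2⌉)
open import Data.Nat.Properties
open import Data.Nat.Tactic.RingSolver using (solve-∀)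
open import Data.Product using (_×_; _,_; ∃-syntax)
open import Data.Sum using (_⊎_; inj₁; inj₂)
open import Function using (_∘_)
open import Relation.Binary using (tri<; tri≈; tri>)
open import Relation.Binary.PropositionalEquality
  using (_≡_; _≢_; refl; sym; trans; cong; ≢-sym)
open import Relation.Nullary using (¬_; Dec; yes; no)
open import Relation.Nullary.Decidable
  using (_×-dec_; _⊎-dec_; ¬?; ⌊_⌋; toWitness; fromWitness; isYes≗does; dec-true; dec-false)

-- Halving and levels of binary labels

-- Two strict steps give `2 + x ≤ z`, so the halves stay strictly ordered; one step would not
-- suffice.
⌊n/2⌋-mono-<₂ : ∀ {x y z} → x < y → y < z → ⌊ x /2⌋ < ⌊ z /2⌋
⌊n/2⌋-mono-<₂ x<y y<z = ⌊n/2⌋-mono (≤-trans (s≤s x<y) y<z)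

⌊n/2⌋<m : ∀ {n m} → n < 2 * m → ⌊ n /2⌋ < m
⌊n/2⌋<m {n} {m} n<2m = ≰⇒> λ m≤⌊n/2⌋ → <⇒≱ n<2m (begin
  m + (m + 0)          ≡⟨ cong (m +_) (+-identityʳ m) ⟩
  m + m                ≤⟨ +-mono-≤ m≤⌊n/2⌋ (≤-trans m≤⌊n/2⌋ (⌊n/2⌋≤⌈n/2⌉ n)) ⟩
  ⌊ n /2⌋ + ⌈ n /2⌉    ≡⟨ ⌊n/2⌋+⌈n/2⌉≡n n ⟩
  n                    ∎)
  where open ≤-Reasoning

-- k is the number of digits inspected, so meaningful for x , y < 2 ^ k only.
level : ℕ → ℕ → ℕ → ℕ
level zero    x y = 0
level (suc k) x y with x ≟ y
... | yes _ = 0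
... | no  _ = suc (level k ⌊ x /2⌋ ⌊ y /2⌋)

level≤ : ∀ k x y → level k x y ≤ k
level≤ zero    x y = z≤n
level≤ (suc k) x y with x ≟ y
... | yes _ = z≤n
... | no  _ = s≤s (level≤ k _ _)

-- Equal nonzero levels pass down to the halves. Only `x < z` is strict because halving may merge
-- `y` with one neighbour; then exactly one of the two levels is zero.
level-≢ : ∀ k {x y z} → x ≤ y → y ≤ z → x < z → z < 2 ^ k → level k x y ≢ level k y z
level-≢ zero    x≤y y≤z x<z z<1 = ⊥-elim (<⇒≱ z<1 (≤-trans z<s x<z))
level-≢ (suc k) {x} {y} {z} x≤y y≤z x<z z<2^1+k with x ≟ y | y ≟ z
... | yes x≡y | yes y≡z = ⊥-elim (<⇒≢ x<z (trans x≡y y≡z))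
... | yes _   | no  _   = λ ()
... | no  _   | yes _   = λ ()
... | no  x≢y | no  y≢z =
  level-≢ k (⌊n/2⌋-mono x≤y) (⌊n/2⌋-mono y≤z)
    (⌊n/2⌋-mono-<₂ (≤∧≢⇒< x≤y x≢y) (≤∧≢⇒< y≤z y≢z)) (⌊n/2⌋<m z<2^1+k)
  ∘ suc-injective

-- The tournament

-- `level` always takes its smaller argument first, so a monotone triple and its reverse compare the
-- same two numbers.
Peak Ascent Descent Link : ℕ → ℕ → ℕ → ℕ → Set
Peak    k x y z = x < y × z < y × x ≢ z
Ascent  k x y z = x < y × y < z × level k x y < level k y z
Descent k x y z = y < x × z < y × level k y x < level k z y
Link    k x y z = Peak k x y z ⊎ Ascent k x y z ⊎ Descent k x y z

link? : ∀ k x y z → Dec (Link k x y z)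
link? k x y z =
  (x <? y ×-dec z <? y ×-dec ¬? (x ≟ z)) ⊎-dec
  (x <? y ×-dec y <? z ×-dec level k x y <? level k y z) ⊎-dec
  (y <? x ×-dec z <? y ×-dec level k y x <? level k z y)

link⇒distinct : ∀ k {x y z} → Link k x y z → x ≢ y × y ≢ z × x ≢ z
link⇒distinct k (inj₁ (x<y , z<y , x≢z)) = <⇒≢ x<y , ≢-sym (<⇒≢ z<y) , x≢z
link⇒distinct k (inj₂ (inj₁ (x<y , y<z , _))) =
  <⇒≢ x<y , <⇒≢ y<z , <⇒≢ (<-trans x<y y<z)
link⇒distinct k (inj₂ (inj₂ (y<x , z<y , _))) =
  ≢-sym (<⇒≢ y<x) , ≢-sym (<⇒≢ z<y) , ≢-sym (<⇒≢ (<-trans z<y y<x))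

¬link-valley : ∀ k {x y z} → y < x → y < z → ¬ Link k x y z
¬link-valley k y<x y<z (inj₁ (x<y , _))        = <-asym x<y y<x
¬link-valley k y<x y<z (inj₂ (inj₁ (x<y , _))) = <-asym x<y y<x
¬link-valley k y<x y<z (inj₂ (inj₂ (_ , z<y , _))) = <-asym z<y y<z

¬link-ascending : ∀ k {x y z} → x < y → y < z →
                  ¬ (level k x y < level k y z) → ¬ Link k x y z
¬link-ascending k x<y y<z l≮ (inj₁ (_ , z<y , _))     = <-asym z<y y<z
¬link-ascending k x<y y<z l≮ (inj₂ (inj₁ (_ , _ , l<))) = l≮ l<
¬link-ascending k x<y y<z l≮ (inj₂ (inj₂ (y<x , _)))  = <-asym x<y y<x

¬link-descending : ∀ k {x y z} → y < x → z < y →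
                   ¬ (level k y x < level k z y) → ¬ Link k x y z
¬link-descending k y<x z<y l≮ (inj₁ (x<y , _))        = <-asym x<y y<x
¬link-descending k y<x z<y l≮ (inj₂ (inj₁ (x<y , _))) = <-asym x<y y<x
¬link-descending k y<x z<y l≮ (inj₂ (inj₂ (_ , _ , l<))) = l≮ l<

linkDigraph : ∀ n → ℕ → Digraph₃ n
linkDigraph n k = digraph
  (λ a b c → ⌊ link? k (toℕ a) (toℕ b) (toℕ c) ⌋)
  λ a b c e →
    let a≢b , b≢c , a≢c = link⇒distinct k (toWitness {a? = link? k (toℕ a) (toℕ b) (toℕ c)} e)
    in a≢b ∘ cong toℕ , b≢c ∘ cong toℕ , a≢c ∘ cong toℕ

edgeCount-↭ : ∀ {n} (G : Digraph₃ n) {a b c d e f : Fin n} →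
              orderings a b c ↭ orderings d e f → edgeCount G a b c ≡ edgeCount G d e f
edgeCount-↭ G p = ↭-length (filter-↭ (edge? G) p)

-- The orderings are paired by first vertex: exchanging `a` and `b` exchanges the first two pairs
-- and flips the third. With `edgeCount-swap₂₃` this sorts any triple.
edgeCount-swap₁₂ : ∀ {n} (G : Digraph₃ n) (a b c : Fin n) →
                   edgeCount G a b c ≡ edgeCount G b a c
edgeCount-swap₁₂ G a b c = edgeCount-↭ G {a} {b} {c}
  (++⁺ (++-comm ((a , b , c) ∷ (a , c , b) ∷ []) ((b , a , c) ∷ (b , c , a) ∷ []))
       (swap _ _ ↭-refl))

edgeCount-swap₂₃ : ∀ {n} (G : Digraph₃ n) (a b c : Fin n) →
                   edgeCount G a b c ≡ edgeCount G a c b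
edgeCount-swap₂₃ G a b c = edgeCount-↭ G {a} {b} {c}
  (++⁺ {x = (a , b , c) ∷ (a , c , b) ∷ []} (swap _ _ ↭-refl)
    (++-comm ((b , a , c) ∷ (b , c , a) ∷ []) ((c , a , b) ∷ (c , b , a) ∷ [])))

module _ (n k : ℕ) where

  private
    G : Digraph₃ n
    G = linkDigraph n k

  edge-true : ∀ a b c → Link k (toℕ a) (toℕ b) (toℕ c) → edge G a b c ≡ true
  edge-true a b c l = trans (isYes≗does l?) (dec-true l? l)
    where l? = link? k (toℕ a) (toℕ b) (toℕ c)

  edge-false : ∀ a b c → ¬ Link k (toℕ a) (toℕ b) (toℕ c) → edge G a b c ≡ false
  edge-false a b c ¬l = trans (isYes≗does l?) (dec-false l? ¬l)
    where l? = link? k (toℕ a) (toℕ b) (toℕ c)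

  -- Both peaks at `c` are edges and both valleys at `a` are not. The two levels differ by
  -- `level-≢`, so exactly one monotone ordering is an edge.
  edgeCount-sorted : n ≤ 2 ^ k → ∀ a b c → toℕ a < toℕ b → toℕ b < toℕ c → edgeCount G a b c ≡ 3
  edgeCount-sorted n≤2^k a b c a<b b<c
    with <-cmp (level k (toℕ a) (toℕ b)) (level k (toℕ b) (toℕ c))
  ... | tri≈ _ l≡ _ = ⊥-elim (level-≢ k (<⇒≤ a<b) (<⇒≤ b<c) (<-trans a<b b<c)
                                (<-≤-trans (toℕ<n c) n≤2^k) l≡)
  ... | tri< l< _ l≯
    rewrite edge-true a b c (inj₂ (inj₁ (a<b , b<c , l<)))
          | edge-true a c b (inj₁ (<-trans a<b b<c , b<c , <⇒≢ a<b))
          | edge-false b a c (¬link-valley k a<b (<-trans a<b b<c))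
          | edge-true b c a (inj₁ (b<c , <-trans a<b b<c , ≢-sym (<⇒≢ a<b)))
          | edge-false c a b (¬link-valley k (<-trans a<b b<c) a<b)
          | edge-false c b a (¬link-descending k b<c a<b l≯) = refl
  ... | tri> l≮ _ l>
    rewrite edge-false a b c (¬link-ascending k a<b b<c l≮)
          | edge-true a c b (inj₁ (<-trans a<b b<c , b<c , <⇒≢ a<b))
          | edge-false b a c (¬link-valley k a<b (<-trans a<b b<c))
          | edge-true b c a (inj₁ (b<c , <-trans a<b b<c , ≢-sym (<⇒≢ a<b)))
          | edge-false c a b (¬link-valley k (<-trans a<b b<c) a<b)
          | edge-true c b a (inj₂ (inj₂ (b<c , a<b , l>))) = refl

  linkDigraph-isTournament : n ≤ 2 ^ k → IsTournament 3 G
  linkDigraph-isTournament n≤2^k a b c (a≢b , b≢c , a≢c)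
    with <-cmp (toℕ a) (toℕ b) | <-cmp (toℕ b) (toℕ c) | <-cmp (toℕ a) (toℕ c)
  ... | tri≈ _ a≡b _ | _ | _ = ⊥-elim (a≢b (toℕ-injective a≡b))
  ... | _ | tri≈ _ b≡c _ | _ = ⊥-elim (b≢c (toℕ-injective b≡c))
  ... | _ | _ | tri≈ _ a≡c _ = ⊥-elim (a≢c (toℕ-injective a≡c))
  ... | tri< a<b _ _ | tri< b<c _ _ | _ = edgeCount-sorted n≤2^k a b c a<b b<c
  ... | tri< a<b _ _ | tri> _ _ c<b | tri< a<c _ _ =
    trans (edgeCount-swap₂₃ G a b c) (edgeCount-sorted n≤2^k a c b a<c c<b)
  ... | tri< a<b _ _ | tri> _ _ c<b | tri> _ _ c<a =
    trans (edgeCount-swap₂₃ G a b c)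
      (trans (edgeCount-swap₁₂ G a c b) (edgeCount-sorted n≤2^k c a b c<a a<b))
  ... | tri> _ _ b<a | tri< b<c _ _ | tri< a<c _ _ =
    trans (edgeCount-swap₁₂ G a b c) (edgeCount-sorted n≤2^k b a c b<a a<c)
  ... | tri> _ _ b<a | tri< b<c _ _ | tri> _ _ c<a =
    trans (edgeCount-swap₁₂ G a b c)
      (trans (edgeCount-swap₂₃ G b a c) (edgeCount-sorted n≤2^k b c a b<c c<a))
  ... | tri> _ _ b<a | tri> _ _ c<b | _ =
    trans (edgeCount-swap₁₂ G a b c) (trans (edgeCount-swap₂₃ G b a c)
      (trans (edgeCount-swap₁₂ G b c a) (edgeCount-sorted n≤2^k c b a c<b b<a)))

-- Length of tight paths

-- Levels are at most `k`, so the shift by `suc k` puts every descending pair above every ascending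
-- one. A peak therefore raises the rank, as do the other links.
rank : ℕ → ℕ → ℕ → ℕ
rank k x y with x <? y
... | yes _ = level k x y
... | no  _ = suc k + level k y x

rank≤ : ∀ k x y → rank k x y ≤ suc k + k
rank≤ k x y with x <? y
... | yes _ = ≤-trans (level≤ k x y) (m≤n+m k (suc k))
... | no  _ = +-monoʳ-≤ (suc k) (level≤ k y x)

link⇒rank< : ∀ k {x y z} → Link k x y z → rank k x y < rank k y z
link⇒rank< k {x} {y} {z} l with x <? y | y <? z | l
... | yes _   | no _    | _ = s≤s (≤-trans (level≤ k x y) (m≤m+n k _))
... | yes _   | yes y<z | inj₁ (_ , z<y , _)            = ⊥-elim (<-asym y<z z<y)
... | yes _   | yes _   | inj₂ (inj₁ (_ , _ , l<))      = l<
... | yes x<y | yes _   | inj₂ (inj₂ (y<x , _))         = ⊥-elim (<-asym x<y y<x)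
... | no x≮y  | _       | inj₁ (x<y , _)                = ⊥-elim (x≮y x<y)
... | no x≮y  | _       | inj₂ (inj₁ (x<y , _))         = ⊥-elim (x≮y x<y)
... | no _    | yes y<z | inj₂ (inj₂ (_ , z<y , _))     = ⊥-elim (<-asym y<z z<y)
... | no _    | no _    | inj₂ (inj₂ (_ , _ , l<))      = +-monoʳ-< (suc k) l<

stepwise-<⇒≤last : ∀ m (g : Fin (suc m) → ℕ) →
                   (∀ i → g (inject₁ i) < g (suc i)) → m ≤ g (fromℕ m)
stepwise-<⇒≤last m g g-< = ≤-trans (m≤m+n m (g zero)) (climb m g g-<)
  where
  -- The induction drops the first term, so the bound has to carry `g zero`.
  climb : ∀ m (g : Fin (suc m) → ℕ) →
          (∀ i → g (inject₁ i) < g (suc i)) → m + g zero ≤ g (fromℕ m)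
  climb zero    g g-< = ≤-refl
  climb (suc m) g g-< = begin
    suc (m + g zero)    ≡⟨ +-suc m (g zero) ⟨
    m + suc (g zero)    ≤⟨ +-monoʳ-≤ m (g-< zero) ⟩
    m + g (suc zero)    ≤⟨ climb m (g ∘ suc) (g-< ∘ suc) ⟩
    g (fromℕ (suc m))   ∎
    where open ≤-Reasoning

-- The indices are written so that the edge overlaps the consecutive pairs numbered `inject₁ i` and
-- `suc i`.
tightPath-edge : ∀ {s} (i : Fin s) →
                 Edge (tightPath (suc (suc s))) (inject₁ (inject₁ i)) (inject₁ (suc i)) (suc (suc i))
tightPath-edge i = fromWitness
  ( cong suc (trans (toℕ-inject₁ i) (sym (trans (toℕ-inject₁ _) (toℕ-inject₁ i))))
  , cong suc (cong suc (sym (toℕ-inject₁ i))) )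

-- A path on `m + 2` vertices has `m + 1` consecutive pairs, whose ranks increase strictly and are
-- at most `2 * k + 1`.
linkDigraph-path≤ : ∀ n k s → Contains (linkDigraph n k) (tightPath s) → s ≤ 2 * k + 3
linkDigraph-path≤ n k zero          _ = z≤n
linkDigraph-path≤ n k (suc zero)    _ = ≤-trans (s≤s z≤n) (m≤n+m 3 (2 * k))
linkDigraph-path≤ n k (suc (suc m)) (φ , _ , hom) = begin
  2 + m              ≤⟨ +-monoʳ-≤ 2 (stepwise-<⇒≤last m g g-<) ⟩
  2 + g (fromℕ m)    ≤⟨ +-monoʳ-≤ 2 (rank≤ k (toℕ (φ (inject₁ (fromℕ m)))) (toℕ (φ (suc (fromℕ m))))) ⟩
  2 + (suc k + k)    ≡⟨ lemma k ⟩
  2 * k + 3          ∎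
  where
  open ≤-Reasoning

  lemma : ∀ k → 2 + (suc k + k) ≡ 2 * k + 3
  lemma = solve-∀

  g : Fin (suc m) → ℕ
  g i = rank k (toℕ (φ (inject₁ i))) (toℕ (φ (suc i)))

  g-< : ∀ i → g (inject₁ i) < g (suc i)
  g-< i = link⇒rank< k (toWitness (hom _ _ _ (tightPath-edge i)))

-- Number of digits and the final bound

2^k-between : ∀ n .{{_ : NonZero n}} → ∃[ k ] n ≤ 2 ^ k × 2 ^ k ≤ 2 * n
2^k-between (suc zero) = 0 , ≤-refl , s≤s z≤n
2^k-between (suc n@(suc _)) with 2^k-between n
... | k , n≤2^k , 2^k≤2n with m≤n⇒m<n∨m≡n n≤2^k
...   | inj₁ n<2^k = k , n<2^k , ≤-trans 2^k≤2n (*-monoʳ-≤ 2 (n≤1+n n))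
-- One more digit is added exactly when `n` is a power of two, so the factor 2 is kept.
...   | inj₂ n≡2^k = suc k , ≤-trans 1+n≤2n (*-monoʳ-≤ 2 n≤2^k) ,
                     *-monoʳ-≤ 2 (≤-trans (≤-reflexive (sym n≡2^k)) (n≤1+n n))
  where
  1+n≤2n : suc n ≤ 2 * n
  1+n≤2n = ≤-trans (s≤s (m≤n+m n _)) (≤-reflexive (cong (n +_) (sym (+-identityʳ n))))

-- The bound in exponential form: taking `lg` of both sides gives `2 lg n + 6`.
theorem27 : (n : ℕ) → .{{_ : NonZero n}} → 2 ^ f n 3 ≤ n ^ 2 * 2 ^ 6
theorem27 n =
  let k , n≤2^k , 2^k≤2n = 2^k-between n
      G                  = linkDigraph n k
      G-isTournament     = linkDigraph-isTournament n k n≤2^k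
      -- `G` is used twice: its existence makes `f n 3` a genuine maximum, and its own paths then
      -- bound that maximum.
      unavoidable , _    = f-isMaximum G G-isTournament
  in begin
  2 ^ f n 3            ≤⟨ ^-monoʳ-≤ 2 (linkDigraph-path≤ n k (f n 3) (unavoidable G G-isTournament)) ⟩
  2 ^ (2 * k + 3)      ≡⟨ ^-distribˡ-+-* 2 (2 * k) 3 ⟩
  2 ^ (2 * k) * 2 ^ 3  ≡⟨ cong (λ e → 2 ^ e * 2 ^ 3) (*-comm 2 k) ⟩
  2 ^ (k * 2) * 2 ^ 3  ≡⟨ cong (_* 2 ^ 3) (^-*-assoc 2 k 2) ⟨
  (2 ^ k) ^ 2 * 2 ^ 3  ≤⟨ *-monoˡ-≤ (2 ^ 3) (^-monoˡ-≤ 2 2^k≤2n) ⟩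
  (2 * n) ^ 2 * 2 ^ 3  ≡⟨ lemma n ⟩
  -- The construction already gives `2 lg n + 5`; this step weakens it.
  n ^ 2 * 2 ^ 5        ≤⟨ *-monoʳ-≤ (n ^ 2) (^-monoʳ-≤ 2 {5} {6} (n≤1+n 5)) ⟩
  n ^ 2 * 2 ^ 6        ∎
  where
  open ≤-Reasoning

  lemma : ∀ n → 2 * n * (2 * n * 1) * 8 ≡ n * (n * 1) * 32
  lemma = solve-∀
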